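{- Let $T$ be a well-pruned nonspecial $\omega_1$-tree. Then $\diamondsuit^*$ implies $\diamondsuit_T$.
   Context: A tree is a partial order $(T,<_T)$ in which the set of predecessors of each node is well-ordered; every tree is assumed to have a root, denoted $\emptyset$. For $t\in T$, $t{\downarrow}=\{s\in T\mid s<_T t\}$, $\mathrm{ht}(t)$ is the order type of $t{\downarrow}$, and $T_\alpha$ is the set of nodes of height $\alpha$. The height of $T$ is the least $\alpha$ with $T_\alpha=\emptyset$. An $\omega_1$-tree is a tree of height $\omega_1$ all of whose levels $T_\alpha$ are countable. A tree $T$ of height $\kappa$ is well-pruned if for all $\alpha<\beta<\kappa$ and $s\in T_\alpha$ there is $t\in T_\beta$ with $s<_T t$. An antichain is a set of pairwise incomparable nodes. A set $U\subseteq T$ is special if it is a union of at most countably many antichains; otherwise it is nonspecial. For $X\subseteq T$, a map $f:X\to T$ is regressive if $f(t)<_T t$ for all $t\in X\setminus\{\emptyset\}$. For $T$ of height $\omega_1$, $NS^T$ is the ideal of all $B\subseteq T$ for which there is a regressive $f:B\to T$ such that $f^{ -1}(\{t\})$ is special for every $t\in T$. For a nonspecial tree $T$ of height $\omega_1$, $\diamondsuit_T$ asserts that there is a sequence $(D_t\mid t\in T)$ with $D_t\subseteq t{\downarrow}$ for all $t\in T$ such that for every $X\subseteq T$, $\{t\in T\mid X\cap t{\downarrow}=D_t\}\notin NS^T$. $\diamondsuit^*$ asserts that there is $(\mathcal D_\alpha)_{\alpha<\omega_1}$ with $\mathcal D_\alpha\subseteq\mathcal P(\alpha)$ and $|\mathcal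 D_\alpha|\le\omega$ such that for every $X\subseteq\omega_1$ the set $\{\alpha<\omega_1\mid X\cap\alpha\in\mathcal D_\alpha\}$ contains a club. -}

module Defs where

open import Level using (Level; 0ℓ; suc; _⊔_)
open import Data.Nat.Base using (ℕ)
open import Data.Product.Base using (Σ; Σ-syntax; ∃-syntax; _×_; proj₁)
open import Function.Bundles using (Injection)
open import Induction.WellFounded using (WellFounded)
open import Relation.Binary.Bundles using (Setoid; StrictPartialOrder)
open import Relation.Binary.Core using (Rel)
open import Relation.Binary.Structures using (IsStrictPartialOrder; IsStrictTotalOrder)
open import Relation.Binary.Morphism.Structures using (IsOrderIsomorphism)
open import Relation.Binary.PropositionalEquality using (_≡_; _≢_; setoid)
import Relation.Binary.Construct.On as On
open import Relation.Nullary using (¬_)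
open import Relation.Unary using (Pred; _∈_; _⊆_; _≐_; _∩_; ⋃; Satisfiable; Empty)
open import Relation.Unary.Relation.Binary.Equality using (≐-setoid)

private
  variable
    a ℓ p : Level

-- Sets are types in Set, subsets are predicates with values in Set, and
-- subsets are compared by extensional equality _≐_.  The notions below are
-- read classically: under ExcludedMiddle, which decides every type and so
-- yields an element of each type that is not empty, choice is available and
-- "there exists" may be expressed by Σ.

-- A subset as a setoid: its elements are compared by their first
-- components, so that membership proofs do not count.
subset : (S : Setoid a ℓ) → Pred (Setoid.Carrier S) p → Setoid (a ⊔ p) ℓ
subset S P = On.setoid {B = Σ (Setoid.Carrier S) P} S proj₁

-- At most countable.
Countable : Setoid a ℓ → Set (a ⊔ ℓ)
Countable S = Injection S (setoid ℕ)

record StrictPoset : Set₁ where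
  infix 4 _<_
  field
    Carrier              : Set
    _<_                  : Rel Carrier 0ℓ
    isStrictPartialOrder : IsStrictPartialOrder _≡_ _<_

  order : StrictPartialOrder 0ℓ 0ℓ 0ℓ
  order = record { isStrictPartialOrder = isStrictPartialOrder }

  infix 8 _↓
  _↓ : Carrier → Pred Carrier 0ℓ
  (t ↓) s = s < t

  segment : Carrier → StrictPartialOrder 0ℓ 0ℓ 0ℓ
  segment t = On.strictPartialOrder {B = Σ Carrier (t ↓)} order proj₁

record IsWellOrder (P : StrictPartialOrder 0ℓ 0ℓ 0ℓ) : Set where
  open StrictPartialOrder P
  field
    isStrictTotalOrder : IsStrictTotalOrder _≈_ _<_
    wellFounded        : WellFounded _<_

infix 4 _≅_
_≅_ : (P Q : StrictPartialOrder 0ℓ 0ℓ 0ℓ) → Set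
P ≅ Q = Σ[ f ∈ (P.Carrier → Q.Carrier) ] IsOrderIsomorphism P._≈_ Q._≈_ P._<_ Q._<_ f
  where
  module P = StrictPartialOrder P
  module Q = StrictPartialOrder Q

-- An ordinal is represented by a well-ordered set of that order type, and
-- the ordinals below it by the elements of that set.  The ordinal ω₁ is the
-- order type of the uncountable well-orders all of whose proper initial
-- segments are countable.
record IsOmega₁ (Ω : StrictPoset) : Set where
  open StrictPoset Ω
  field
    isWellOrder       : IsWellOrder order
    uncountable       : ¬ Countable (setoid Carrier)
    segmentsCountable : ∀ α → Countable (subset (setoid Carrier) (α ↓))

record Tree : Set₁ where
  field
    poset : StrictPoset
  open StrictPoset poset public renaming (Carrier to Node)
  field
    predecessorsWellOrdered : ∀ t → IsWellOrder (segment t)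
    root                    : Node
    root-least              : ∀ t → t ≢ root → root < t

  -- The nodes whose height is the order type of A.
  Level[_] : StrictPartialOrder 0ℓ 0ℓ 0ℓ → Pred Node 0ℓ
  Level[ A ] t = segment t ≅ A

  Antichain : Pred (Pred Node 0ℓ) 0ℓ
  Antichain A = ∀ {s t} → s ∈ A → t ∈ A → ¬ (s < t)

  -- The empty antichain is allowed, so unions of families indexed by ℕ are
  -- the unions of at most countably many antichains.
  Special : Pred (Pred Node 0ℓ) (suc 0ℓ)
  Special V = Σ[ A ∈ (ℕ → Pred Node 0ℓ) ] (∀ n → Antichain (A n)) × V ≐ ⋃ ℕ A

  -- A map defined on X is represented by a map on all nodes, whose values
  -- outside X are irrelevant.
  Regressive : Pred Node 0ℓ → (Node → Node) → Set
  Regressive X f = ∀ t → t ∈ X → t ≢ root → f t < t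

  NS : Pred (Pred Node 0ℓ) (suc 0ℓ)
  NS B = Σ[ f ∈ (Node → Node) ] Regressive B f × (∀ t → Special (B ∩ (λ s → f s ≡ t)))

  ◇ : Set₁
  ◇ = Σ[ D ∈ (Node → Pred Node 0ℓ) ] (∀ t → D t ⊆ t ↓)
      × (∀ (X : Pred Node 0ℓ) → ¬ NS (λ t → (X ∩ t ↓) ≐ D t))

module _ (κ : StrictPoset) (T : Tree) where
  private
    module κ = StrictPoset κ
  open Tree T

  -- κ is the least ordinal whose level is empty.
  record HasHeight : Set where
    field
      nonempty-below : ∀ α → Satisfiable Level[ κ.segment α ]
      empty-at       : Empty Level[ κ.order ]

  -- Meant for trees of height κ.
  WellPruned : Set
  WellPruned = ∀ {α β} → α κ.< β → ∀ s → s ∈ Level[ κ.segment α ] →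
               ∃[ t ] t ∈ Level[ κ.segment β ] × s < t

-- ω₁ is meant to satisfy IsOmega₁.
record IsOmega₁Tree (ω₁ : StrictPoset) (T : Tree) : Set where
  open Tree T
  field
    hasHeight       : HasHeight ω₁ T
    levelsCountable : ∀ α → Countable (subset (setoid Node) Level[ StrictPoset.segment ω₁ α ])

module _ (ω₁ : StrictPoset) where
  open StrictPoset ω₁

  Unbounded : Pred (Pred Carrier 0ℓ) 0ℓ
  Unbounded C = ∀ α → ∃[ β ] β ∈ C × α < β

  -- A δ as in the hypothesis is automatically a nonzero limit ordinal.
  Closed : Pred (Pred Carrier 0ℓ) 0ℓ
  Closed C = ∀ δ → Satisfiable (δ ↓) →
             (∀ α → α < δ → ∃[ β ] β ∈ C × α < β × β < δ) → δ ∈ C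

  Club : Pred (Pred Carrier 0ℓ) 0ℓ
  Club C = Unbounded C × Closed C

  ContainsClub : Pred (Pred Carrier p) (suc 0ℓ ⊔ p)
  ContainsClub S = Σ[ C ∈ Pred Carrier 0ℓ ] Club C × C ⊆ S

  -- Membership of a subset in a family of subsets, up to _≐_.
  infix 4 _∈≐_
  _∈≐_ : Pred Carrier 0ℓ → Pred (Pred Carrier 0ℓ) 0ℓ → Set₁
  X ∈≐ 𝓕 = Σ[ D ∈ Pred Carrier 0ℓ ] D ∈ 𝓕 × D ≐ X

  ◇* : Set₁
  ◇* = Σ[ 𝒟 ∈ (Carrier → Pred (Pred Carrier 0ℓ) 0ℓ) ]
       (∀ α D → D ∈ 𝒟 α → D ⊆ α ↓)
       × (∀ α → Countable (subset (≐-setoid Carrier 0ℓ) (𝒟 α)))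
       × (∀ (X : Pred Carrier 0ℓ) → ContainsClub (λ α → (X ∩ α ↓) ∈≐ 𝒟 α))

{-# OPTIONS --safe #-}

-- Kunen's derivation of ◇ from a countable-guess version, carried out in T.
-- Through an injection of T × ℕ into ω₁, the n-th set of 𝒟 at height ht t
-- yields an n-th guess at t.  If for every n some X n defeats the n-th
-- guesses, then the code of {(s , n) | s ∈ X n} is captured at all nodes
-- whose heights lie in some club and are closed under the coding.  The nodes
-- of other heights form a set in NS, so T is a countable union of sets in NS
-- and thus lies in NS itself.  Then T is special: the chain
-- t > f t > f (f t) > … of a regressive f reaches the root after finitely
-- many steps, and the indices of the antichains met along it determine t
-- among the nodes comparable with it.

module Submission where

open import Level using (0ℓ; suc; Lift; lift; lower)
open import Axiom.ExcludedMiddle using (ExcludedMiddle)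
open import Axiom.DoubleNegationElimination using (em⇒dne)
import Data.Nat.Base as ℕ
open ℕ using (ℕ)
import Data.Nat.Properties as ℕ
open import Data.Product.Base using (Σ; Σ-syntax; ∃; ∃-syntax; _×_; _,_; proj₁; proj₂)
open import Data.Sum.Base using (_⊎_; inj₁; inj₂)
open import Function.Bundles using (Injection)
open import Induction.WellFounded using (WellFounded; Acc; acc)
open import Relation.Binary.Bundles using (StrictPartialOrder)
open import Relation.Binary.Definitions using (Tri; tri<; tri≈; tri>; Trichotomous)
open import Relation.Binary.Morphism.Structures using (IsOrderIsomorphism)
open import Relation.Binary.PropositionalEquality
  using (_≡_; _≢_; refl; sym; trans; cong; subst)
open import Relation.Binary.Structures using (IsStrictTotalOrder)
open import Relation.Nullary using (¬_; Dec; yes; no; contradiction)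
open import Relation.Nullary.Decidable using (map′)
open import Relation.Unary using (Pred; _∈_; _∉_; _⊆_; _≐_; _∩_; ⋃; U; ∅)
open import Defs

-- Pairing of natural numbers

pair : ℕ → ℕ → ℕ
pair ℕ.zero    n = ℕ.suc (2 ℕ.* n)
pair (ℕ.suc m) n = 2 ℕ.* pair m n

-- The code is `2 ^ m * (2 * n + 1)`, so parity decides whether another factor 2 can be cancelled.
pair-injective : ∀ m m′ {n n′} → pair m n ≡ pair m′ n′ → m ≡ m′ × n ≡ n′
pair-injective ℕ.zero    ℕ.zero     {n} {n′} eq =
  refl , ℕ.*-cancelˡ-≡ n n′ 2 (ℕ.suc-injective eq)
pair-injective ℕ.zero    (ℕ.suc m′) {n} {n′} eq =
  contradiction (sym eq) (ℕ.even≢odd (pair m′ n′) n)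
pair-injective (ℕ.suc m) ℕ.zero     {n} {n′} eq =
  contradiction eq (ℕ.even≢odd (pair m n) n′)
pair-injective (ℕ.suc m) (ℕ.suc m′) eq
  with refl , n≡n′ ← pair-injective m m′ (ℕ.*-cancelˡ-≡ _ _ 2 eq) = refl , n≡n′

-- Isomorphisms of strict orders

module _ {P Q : StrictPartialOrder 0ℓ 0ℓ 0ℓ} where
  private
    module P = StrictPartialOrder P
    module Q = StrictPartialOrder Q

  -- By trichotomy in `P`, any failure of injectivity or of order reflection would contradict
  -- irreflexivity or asymmetry in `Q`.
  strictlyMonotone-≅ : Trichotomous P._≈_ P._<_ →
                       (f : P.Carrier → Q.Carrier) →
                       (∀ {x y} → x P.≈ y → f x Q.≈ f y) →
                       (∀ {x y} → x P.< y → f x Q.< f y) →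
                       (∀ y → ∃[ x ] f x Q.≈ y) → P ≅ Q
  strictlyMonotone-≅ compare f f-cong f-mono f-onto = f , record
    { isOrderMonomorphism = record
      { isOrderHomomorphism = record { cong = f-cong ; mono = f-mono }
      ; injective           = injective
      ; cancel              = cancel
      }
    ; surjective = λ y → let x , fx≈y = f-onto y in x , λ z≈x → Q.Eq.trans (f-cong z≈x) fx≈y
    }
    where
    injective : ∀ {x y} → f x Q.≈ f y → x P.≈ y
    injective {x} {y} fx≈fy with compare x y
    ... | tri< x<y _ _ = contradiction (f-mono x<y) (Q.irrefl fx≈fy)
    ... | tri≈ _ x≈y _ = x≈y
    ... | tri> _ _ y<x = contradiction (f-mono y<x) (Q.irrefl (Q.Eq.sym fx≈fy))

    cancel : ∀ {x y} → f x Q.< f y → x P.< y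
    cancel {x} {y} fx<fy with compare x y
    ... | tri< x<y _ _ = x<y
    ... | tri≈ _ x≈y _ = contradiction fx<fy (Q.irrefl (f-cong x≈y))
    ... | tri> _ _ y<x = contradiction fx<fy (Q.asym (f-mono y<x))

-- Consequences of excluded middle

module Classical (em : ExcludedMiddle (suc 0ℓ)) where

  em₀ : ExcludedMiddle 0ℓ
  em₀ {P} = map′ lower lift (em {Lift (suc 0ℓ) P})

  dne : {P : Set} → ¬ ¬ P → P
  dne = em⇒dne em₀

  ¬∀⇒∃¬ : {A : Set} {P : Pred A 0ℓ} → ¬ (∀ x → P x) → ∃[ x ] ¬ P x
  ¬∀⇒∃¬ ¬∀ = dne λ ¬∃ → ¬∀ λ x → dne λ ¬Px → ¬∃ (x , ¬Px)

  minimal : {A : Set} {_<_ : A → A → Set} → WellFounded _<_ → {P : Pred A 0ℓ} →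
            ∃ P → ∃[ x ] P x × (∀ {y} → y < x → ¬ P y)
  minimal {_<_ = _<_} wf {P} (x , Px) = go x (wf x) Px
    where
    go : ∀ x → Acc _<_ x → P x → ∃[ x ] P x × (∀ {y} → y < x → ¬ P y)
    go x (acc rs) Px with em₀ {∃[ y ] y < x × P y}
    ... | yes (y , y<x , Py) = go y (rs y<x) Py
    ... | no  none           = x , Px , λ y<x Py → none (_ , y<x , Py)

-- Trees

module TreeProperties (T : Tree) where
  open Tree T
  open StrictPartialOrder order using (irrefl; asym) renaming (trans to <-trans)

  compare↓ : ∀ {r s t} → r < t → s < t → Tri (r < s) (r ≡ s) (s < r)
  compare↓ {t = t} r<t s<t = IsStrictTotalOrder.compare
    (IsWellOrder.isStrictTotalOrder (predecessorsWellOrdered t)) (_ , r<t) (_ , s<t)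

  -- Descent from `t` stays inside the segment of `t`, which is well-ordered.
  <-wellFounded : WellFounded _<_
  <-wellFounded t = acc λ s<t →
    below (IsWellOrder.wellFounded (predecessorsWellOrdered t) (_ , s<t))
    where
    below : ∀ {s} {s<t : s < t} → Acc (StrictPartialOrder._<_ (segment t)) (s , s<t) → Acc _<_ s
    below {s<t = s<t} (acc rs) = acc λ r<s → below (rs {_ , <-trans r<s s<t} r<s)

  ≮root : ∀ {s} → ¬ (s < root)
  ≮root {s} s<root = asym s<root (root-least s λ { refl → irrefl refl s<root })

  -- `Special` asks for an exact union; cutting a cover down to `V` provides it.
  special-cover : {V : Pred Node 0ℓ} (A : ℕ → Pred Node 0ℓ) →
                  (∀ n → Antichain (A n)) → V ⊆ ⋃ ℕ A → Special V
  special-cover {V} A antichain V⊆A =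
    (λ n → V ∩ A n) , (λ n s∈ t∈ → antichain n (proj₂ s∈) (proj₂ t∈)) ,
    (λ t∈V → let n , t∈An = V⊆A t∈V in n , t∈V , t∈An) , (λ (n , t∈V , _) → t∈V)

  module _ {f : Node → Node} (regressive : Regressive U f)
           (specialFibres : ∀ t → Special (U ∩ (λ s → f s ≡ t))) where
    private
      A : Node → ℕ → Pred Node 0ℓ
      A t = proj₁ (specialFibres t)

      -- `c` codes the list of antichain indices met along `t`, `f t`, `f (f t)`, ...; the successor
      -- keeps nonempty lists apart from the code 0 of the root.
      data Chain : Node → ℕ → Set where
        stop : Chain root 0
        step : ∀ {t m c} → t ≢ root → t ∈ A (f t) m → Chain (f t) c →
               Chain t (ℕ.suc (pair m c))

      infix 4 _⊑_
      _⊑_ : Node → Node → Set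
      s ⊑ t = s < t ⊎ s ≡ t

      <-⊑ : ∀ {r s t} → r < s → s ⊑ t → r < t
      <-⊑ r<s (inj₁ s<t)  = <-trans r<s s<t
      <-⊑ r<s (inj₂ refl) = r<s

      antichain-⊑ : ∀ {V : Pred Node 0ℓ} {s t u} → Antichain V → s ∈ V → t ∈ V →
                    s ⊑ u → t ⊑ u → s ≡ t
      antichain-⊑ V-anti s∈ t∈ (inj₁ s<u) (inj₁ t<u) with compare↓ s<u t<u
      ... | tri< s<t _ _ = contradiction s<t (V-anti s∈ t∈)
      ... | tri≈ _ s≡t _ = s≡t
      ... | tri> _ _ t<s = contradiction t<s (V-anti t∈ s∈)
      antichain-⊑ V-anti s∈ t∈ (inj₁ s<u)  (inj₂ refl) = contradiction s<u (V-anti s∈ t∈)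
      antichain-⊑ V-anti s∈ t∈ (inj₂ refl) (inj₁ t<u)  = contradiction t<u (V-anti t∈ s∈)
      antichain-⊑ V-anti s∈ t∈ (inj₂ refl) (inj₂ refl) = refl

      -- Equal codes have equal tails, so `f s ≡ f t` by induction. Then `s` and `t` lie in one
      -- antichain of one fibre, and they coincide because the common bound `u` makes them
      -- comparable.
      chain-injective : ∀ {s t u c} → Chain s c → Chain t c → s ⊑ u → t ⊑ u → s ≡ t
      -- Separate codes `c` and `d` let both chains be matched before the codes are compared.
      chain-injective p q = go p q refl
        where
        go : ∀ {s t u c d} → Chain s c → Chain t d → c ≡ d → s ⊑ u → t ⊑ u → s ≡ t
        go stop stop _ _ _ = refl
        go (step {s} {m} s≢root s∈ p) (step {t} {m′} t≢root t∈ q) eq s⊑u t⊑u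
          with refl , c≡d ← pair-injective m m′ (ℕ.suc-injective eq) =
          antichain-⊑ (proj₁ (proj₂ (specialFibres (f s))) m)
            s∈ (subst (λ r → t ∈ A r m) (sym fs≡ft) t∈) s⊑u t⊑u
          where
          fs≡ft : f s ≡ f t
          fs≡ft = go p q c≡d (inj₁ (<-⊑ (regressive s _ s≢root) s⊑u))
                             (inj₁ (<-⊑ (regressive t _ t≢root) t⊑u))

    special-if-special-fibres : ExcludedMiddle 0ℓ → Special U
    special-if-special-fibres em₀ = special-cover (λ c t → Chain t c)
      (λ c p q s<t → irrefl (chain-injective p q (inj₁ s<t) (inj₂ refl)) s<t)
      (λ {t} _ → chain t (<-wellFounded t))
      where
      chain : ∀ t → Acc _<_ t → ∃[ c ] Chain t c
      chain t (acc rs) with em₀ {t ≡ root}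
      ... | yes refl  = 0 , stop
      ... | no t≢root =
        let m , t∈ = proj₁ (proj₂ (proj₂ (specialFibres (f t)))) (_ , refl)
            c , p  = chain (f t) (rs (regressive t _ t≢root))
        in ℕ.suc (pair m c) , step t≢root t∈ p

  module _ (em₀ : ExcludedMiddle 0ℓ) where

    special-if-NS : NS U → Special U
    special-if-NS (f , regressive , specialFibres) =
      special-if-special-fibres regressive specialFibres em₀

    -- Each node of `V` follows `f n` for one chosen `B n` containing it. A fibre of this map is
    -- covered by the antichains of countably many fibres, reindexed by `pair`.
    NS-⋃ : {V : Pred Node 0ℓ} (B : ℕ → Pred Node 0ℓ) → (∀ n → NS (B n)) → V ⊆ ⋃ ℕ B → NS V
    NS-⋃ {V} B ns V⊆B = (λ t → g t em₀) , regressive , special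
      where
      f : ℕ → Node → Node
      f n = proj₁ (ns n)

      A : ℕ → Node → ℕ → Pred Node 0ℓ
      A n t = proj₁ (proj₂ (proj₂ (ns n)) t)

      g : ∀ t → Dec (∃[ n ] t ∈ B n) → Node
      g t (yes (n , _)) = f n t
      -- A default value, never taken on `V`.
      g t (no _)        = t

      regressive : Regressive V (λ t → g t em₀)
      regressive t t∈V t≢root with em₀ {∃[ n ] t ∈ B n}
      ... | yes (n , t∈B) = proj₁ (proj₂ (ns n)) t t∈B t≢root
      ... | no  none      = contradiction (V⊆B t∈V) none

      special : ∀ t → Special (V ∩ (λ s → g s em₀ ≡ t))
      special t = special-cover
        (λ k s → ∃[ n ] ∃[ m ] pair n m ≡ k × s ∈ A n t m) antichain cover
        where
        antichain : ∀ k → Antichain (λ s → ∃[ n ] ∃[ m ] pair n m ≡ k × s ∈ A n t m)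
        antichain k (n , m , p , s∈) (n′ , m′ , p′ , s′∈)
          with refl , refl ← pair-injective n n′ (trans p (sym p′)) =
          proj₁ (proj₂ (proj₂ (proj₂ (ns n)) t)) m s∈ s′∈

        cover : ∀ {s} → s ∈ V × g s em₀ ≡ t →
                ∃[ k ] ∃[ n ] ∃[ m ] pair n m ≡ k × s ∈ A n t m
        cover {s} (s∈V , gs≡t) with em₀ {∃[ n ] s ∈ B n}
        ... | no none       = contradiction (V⊆B s∈V) none
        ... | yes (n , s∈B) =
          let m , s∈A = proj₁ (proj₂ (proj₂ (proj₂ (proj₂ (ns n)) t))) (s∈B , gs≡t)
          in pair n m , n , m , refl , s∈A

-- The ordinal ω₁

module Omega₁Properties (em : ExcludedMiddle (suc 0ℓ))
                        (ω₁ : StrictPoset) (isOmega₁ : IsOmega₁ ω₁) where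
  open Classical em
  open StrictPoset ω₁
  open IsOmega₁ isOmega₁
  open IsWellOrder isWellOrder
  open IsStrictTotalOrder isStrictTotalOrder using (compare)

  -- Meant for α ≤ γ: it numbers the elements of γ ∪ {γ}.
  number : Carrier → Carrier → ℕ
  number γ α with compare α γ
  ... | tri< α<γ _ _ = ℕ.suc (Injection.to (segmentsCountable γ) (α , α<γ))
  ... | tri≈ _ _ _   = 0
  ... | tri> _ _ _   = 0

  -- The successor in `number` keeps the elements below `γ` apart from `γ` itself, which gets 0. The
  -- hypotheses exclude elements above `γ`, where 0 is a default.
  number-injective : ∀ {γ α β} → ¬ γ < α → ¬ γ < β → number γ α ≡ number γ β → α ≡ β
  number-injective {γ} {α} {β} γ≮α γ≮β eq with compare α γ | compare β γ
  ... | tri> _ _ γ<α  | _            = contradiction γ<α γ≮α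
  ... | _             | tri> _ _ γ<β = contradiction γ<β γ≮β
  ... | tri< _ _ _    | tri< _ _ _   = Injection.injective (segmentsCountable γ) (ℕ.suc-injective eq)
  ... | tri≈ _ refl _ | tri≈ _ β≡γ _ = sym β≡γ

  -- Otherwise each `α` is at most some `g n`, and `n` together with the number of `α` within `g n`
  -- injects ω₁ into ℕ.
  bounded : (g : ℕ → Carrier) → ∃[ β ] ∀ n → g n < β
  bounded g = dne λ unbounded →
    let above : ∀ α → ∃[ n ] ¬ g n < α
        above α = ¬∀⇒∃¬ λ g<α → unbounded (α , g<α)
    in uncountable record
      { to        = λ α → let n , _ = above α in pair n (number (g n) α)
      ; cong      = λ { refl → refl }
      ; injective = λ {α} {β} eq → injective (above α) (above β) eq
      }
    where
    injective : ∀ {α β} (p : ∃[ n ] ¬ g n < α) (q : ∃[ n ] ¬ g n < β) →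
                pair (proj₁ p) (number (g (proj₁ p)) α) ≡ pair (proj₁ q) (number (g (proj₁ q)) β) →
                α ≡ β
    injective (n , p) (n′ , q) eq with refl , eq′ ← pair-injective n n′ eq =
      number-injective p q eq′

  private
    -- Applied to a constant sequence, `bounded` shows that no element is largest.
    leastAbove : ∀ α → ∃[ β ] α < β × (∀ {γ} → γ < β → ¬ α < γ)
    leastAbove α = let β , α<β = bounded (λ _ → α) in minimal wellFounded (β , α<β 0)

  next : Carrier → Carrier
  next α = proj₁ (leastAbove α)

  <next : ∀ α → α < next α
  <next α = proj₁ (proj₂ (leastAbove α))

  next-injective : ∀ {α β} → next α ≡ next β → α ≡ β
  next-injective {α} {β} eq with compare α β
  ... | tri< α<β _ _ = contradiction α<β (proj₂ (proj₂ (leastAbove α)) (subst (β <_) (sym eq) (<next β)))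
  ... | tri≈ _ α≡β _ = α≡β
  ... | tri> _ _ β<α = contradiction β<α (proj₂ (proj₂ (leastAbove β)) (subst (α <_) eq (<next α)))

  infixl 6 _⊕_
  _⊕_ : Carrier → ℕ → Carrier
  α ⊕ ℕ.zero  = α
  α ⊕ ℕ.suc n = next (α ⊕ n)

  Nonsuccessor : Pred Carrier 0ℓ
  Nonsuccessor α = ∀ β → next β ≢ α

  -- Cancel `next` on both sides; a side that runs out first would be a successor after all.
  ⊕-injective : ∀ {α β} → Nonsuccessor α → Nonsuccessor β → ∀ m n → α ⊕ m ≡ β ⊕ n → α ≡ β × m ≡ n
  ⊕-injective α-non β-non ℕ.zero    ℕ.zero    eq = eq , refl
  ⊕-injective α-non β-non ℕ.zero    (ℕ.suc n) eq = contradiction (sym eq) (α-non _)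
  ⊕-injective α-non β-non (ℕ.suc m) ℕ.zero    eq = contradiction eq (β-non _)
  ⊕-injective α-non β-non (ℕ.suc m) (ℕ.suc n) eq
    with α≡β , refl ← ⊕-injective α-non β-non m n (next-injective eq) = α≡β , refl

  -- Passing to predecessors stops at a nonsuccessor, by well-foundedness.
  decompose : ∀ α → ∃[ μ ] Nonsuccessor μ × ∃[ k ] μ ⊕ k ≡ α
  decompose α = go (wellFounded α)
    where
    go : ∀ {α} → Acc _<_ α → ∃[ μ ] Nonsuccessor μ × ∃[ k ] μ ⊕ k ≡ α
    go {α} (acc rs) with em₀ {∃[ β ] next β ≡ α}
    ... | no none          = α , (λ β eq → none (β , eq)) , 0 , refl
    ... | yes (β , refl) =
      let μ , μ-non , k , eq = go (rs (<next β)) in μ , μ-non , ℕ.suc k , cong next eq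

  -- ω₁ = Λ × ω, where Λ is the set of nonsuccessors, hence
  -- ω₁ × ω = Λ × (ω × ω) embeds into ω₁ through the pairing of naturals.
  code : Carrier → ℕ → Carrier
  code α n = let μ , _ , k , _ = decompose α in μ ⊕ pair k n

  code-injective : ∀ α β {m n} → code α m ≡ code β n → α ≡ β × m ≡ n
  code-injective α β {m} {n} eq with decompose α | decompose β
  ... | μ , μ-non , k , refl | ν , ν-non , l , refl
    with refl , eq′ ← ⊕-injective μ-non ν-non (pair k m) (pair l n) eq
    with refl , m≡n ← pair-injective k l eq′ = refl , m≡n

-- Heights

module Heights (em : ExcludedMiddle (suc 0ℓ))
               (ω₁ : StrictPoset) (isOmega₁ : IsOmega₁ ω₁)
               (T : Tree) (isTree : IsOmega₁Tree ω₁ T) where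
  open Classical em
  open Omega₁Properties em ω₁ isOmega₁
  open StrictPoset ω₁ using () renaming (Carrier to Ord; _<_ to _≺_; segment to segmentΩ; order to orderΩ)
  open IsOmega₁ isOmega₁
  open IsWellOrder isWellOrder using (isStrictTotalOrder) renaming (wellFounded to ≺-wellFounded)
  open IsStrictTotalOrder isStrictTotalOrder using ()
    renaming (compare to ≺-compare; irrefl to ≺-irrefl; trans to ≺-trans)
  open Tree T
  open StrictPartialOrder order using (irrefl) renaming (trans to <-trans)
  open TreeProperties T
  open IsOmega₁Tree isTree
  open HasHeight hasHeight

  module Rank {t α} (F : segment t ≅ segmentΩ α) where
    open IsOrderIsomorphism (proj₂ F) public using (mono; cancel)

    rank : ∀ {s} → s < t → Ord
    rank s<t = proj₁ (proj₁ F (_ , s<t))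

    rank-≺ : ∀ {s} (s<t : s < t) → rank s<t ≺ α
    rank-≺ s<t = proj₂ (proj₁ F (_ , s<t))

    unrank : ∀ {β} → β ≺ α → ∃[ s ] Σ[ s<t ∈ s < t ] rank s<t ≡ β
    unrank β≺α =
      let (s , s<t) , eq = IsOrderIsomorphism.surjective (proj₂ F) (_ , β≺α)
      in s , s<t , eq refl

  open Rank using (rank; rank-≺; unrank; mono; cancel)

  private
    -- If `F` ranks `r` lower than `G` does, then `G` takes that lower value at some `r′ < r`. By
    -- agreement below `r`, `F` would give `r′` and `r` the same rank.
    rank-⊀ : ∀ {s t α β r} (F : segment s ≅ segmentΩ α) (G : segment t ≅ segmentΩ β)
             (p : r < s) (q : r < t) →
             (∀ {r′} → r′ < r → (p′ : r′ < s) (q′ : r′ < t) → rank F p′ ≡ rank G q′) →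
             ¬ rank F p ≺ rank G q
    rank-⊀ F G p q agree F≺G =
      let r′ , q′ , eq = unrank G (≺-trans F≺G (rank-≺ G q))
          r′<r = cancel G {_ , q′} {_ , q} (subst (_≺ rank G q) (sym eq) F≺G)
          p′   = <-trans r′<r p
      in ≺-irrefl (trans (agree r′<r p′ q′) eq) (mono F {_ , p′} {_ , p} r′<r)

  rank-unique : ∀ {s t α β} (F : segment s ≅ segmentΩ α) (G : segment t ≅ segmentΩ β) →
                ∀ {r} (p : r < s) (q : r < t) → rank F p ≡ rank G q
  rank-unique {s} {t} F G {r} = go (<-wellFounded r)
    where
    go : ∀ {r} → Acc _<_ r → (p : r < s) (q : r < t) → rank F p ≡ rank G q
    go (acc rs) p q with ≺-compare (rank F p) (rank G q)
    ... | tri< F≺G _ _ = contradiction F≺G (rank-⊀ F G p q λ r′<r → go (rs r′<r))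
    ... | tri≈ _ eq _  = eq
    ... | tri> _ _ G≺F =
      contradiction G≺F (rank-⊀ G F q p λ r′<r q′ p′ → sym (go (rs r′<r) p′ q′))

  -- If the rank were smaller than `α`, some `r < s` would share it; if larger, some `r < s` would
  -- have rank `α` under `F`, whose values are below `α`.
  rank≡height : ∀ {s t α β} (F : segment s ≅ segmentΩ α) (G : segment t ≅ segmentΩ β)
                (s<t : s < t) → rank G s<t ≡ α
  rank≡height {α = α} F G s<t with ≺-compare (rank G s<t) α
  ... | tri≈ _ eq _ = eq
  ... | tri< G≺α _ _ =
    let r , r<s , eq = unrank F G≺α
        r<t = <-trans r<s s<t
    in contradiction (mono G {_ , r<t} {_ , s<t} r<s)
         (≺-irrefl (trans (rank-unique G F r<t r<s) eq))
  ... | tri> _ _ α≺G =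
    let r , r<t , eq = unrank G (≺-trans α≺G (rank-≺ G s<t))
        r<s = cancel G {_ , r<t} {_ , s<t} (subst (_≺ rank G s<t) (sym eq) α≺G)
    in contradiction (rank-≺ F r<s) (≺-irrefl (trans (rank-unique F G r<s r<t) eq))

  -- If `α ≺ β`, the node of rank `α` under `G` has a rank below `α` under `F`.
  height-unique : ∀ {t α β} → segment t ≅ segmentΩ α → segment t ≅ segmentΩ β → α ≡ β
  height-unique {t} F G = go F G (≺-compare _ _)
    where
    ⊀ : ∀ {α β} → segment t ≅ segmentΩ α → segment t ≅ segmentΩ β → ¬ α ≺ β
    ⊀ F G α≺β = let r , r<t , eq = unrank G α≺β in
      ≺-irrefl (trans (rank-unique F G r<t r<t) eq) (rank-≺ F r<t)

    go : ∀ {α β} → segment t ≅ segmentΩ α → segment t ≅ segmentΩ β →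
         Tri (α ≺ β) (α ≡ β) (β ≺ α) → α ≡ β
    go F G (tri< α≺β _ _) = contradiction α≺β (⊀ F G)
    go F G (tri≈ _ eq _)  = eq
    go F G (tri> _ _ β≺α) = contradiction β≺α (⊀ G F)

  -- By induction the heights of the predecessors of `t` form an initial segment of ω₁. It is not
  -- all of ω₁, since level ω₁ is empty, and its least missed element is the height of `t`.
  hasLevel : ∀ t → ∃[ α ] t ∈ Level[ segmentΩ α ]
  hasLevel t = go (<-wellFounded t)
    where
    go : ∀ {t} → Acc _<_ t → ∃[ α ] t ∈ Level[ segmentΩ α ]
    go {t} (acc rs) = decide em₀
      where
      level : ∀ {s} (s<t : s < t) → ∃[ α ] s ∈ Level[ segmentΩ α ]
      level s<t = go (rs s<t)

      h : Σ Node (t ↓) → Ord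
      h (s , s<t) = proj₁ (level s<t)

      h-cong : ∀ {x y} → proj₁ x ≡ proj₁ y → h x ≡ h y
      h-cong {_ , p} {_ , q} refl = height-unique (proj₂ (level p)) (proj₂ (level q))

      h-mono : ∀ {x y} → proj₁ x < proj₁ y → h x ≺ h y
      h-mono {_ , p} {_ , q} r<s = subst (_≺ _)
        (rank≡height (proj₂ (level p)) (proj₂ (level q)) r<s) (rank-≺ (proj₂ (level q)) r<s)

      h-initial : ∀ x {β} → β ≺ h x → ∃[ y ] h y ≡ β
      h-initial (s , s<t) β≺h =
        let r , r<s , eq = unrank (proj₂ (level s<t)) β≺h
            r<t = <-trans r<s s<t
        in (r , r<t) , trans (sym (rank≡height (proj₂ (level r<t)) (proj₂ (level s<t)) r<s)) eq

      compare : Trichotomous _ _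
      compare = IsStrictTotalOrder.compare
        (IsWellOrder.isStrictTotalOrder (predecessorsWellOrdered t))

      decide : Dec (∃[ α ] ∀ x → h x ≢ α) → ∃[ α ] t ∈ Level[ segmentΩ α ]
      decide (no onto) = contradiction
        (strictlyMonotone-≅ {segment t} {orderΩ} compare h h-cong h-mono λ α →
          dne λ missed → onto (α , λ x eq → missed (x , eq)))
        (empty-at t)
      decide (yes missed) with minimal ≺-wellFounded missed
      ... | α , α-missed , least = α , strictlyMonotone-≅ {segment t} {segmentΩ α} compare
        (λ x → h x , h≺α x) h-cong h-mono
        λ (β , β≺α) → dne λ β-missed → least β≺α λ x eq → β-missed (x , eq)
        where
        h≺α : ∀ x → h x ≺ α
        h≺α x with ≺-compare (h x) α
        ... | tri< h≺α _ _ = h≺α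
        ... | tri≈ _ eq _  = contradiction eq (α-missed x)
        ... | tri> _ _ α≺h = let y , eq = h-initial x α≺h in contradiction eq (α-missed y)

  ht : Node → Ord
  ht t = proj₁ (hasLevel t)

  ht-mono : ∀ {s t} → s < t → ht s ≺ ht t
  ht-mono {s} {t} s<t = subst (_≺ ht t)
    (rank≡height (proj₂ (hasLevel s)) (proj₂ (hasLevel t)) s<t) (rank-≺ (proj₂ (hasLevel t)) s<t)

  restrict : ∀ t {β} → β ≺ ht t → ∃[ s ] s < t × ht s ≡ β
  restrict t β≺ =
    let s , s<t , eq = unrank (proj₂ (hasLevel t)) β≺
    in s , s<t , trans (sym (rank≡height (proj₂ (hasLevel s)) (proj₂ (hasLevel t)) s<t)) eq

  levelIndex : Node → ℕ
  levelIndex t = Injection.to (levelsCountable (ht t)) (t , proj₂ (hasLevel t))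

  levelIndex-injective : ∀ {s t} → ht s ≡ ht t → levelIndex s ≡ levelIndex t → s ≡ t
  levelIndex-injective {s} {t} = go (proj₂ (hasLevel s)) (proj₂ (hasLevel t))
    where
    -- With the heights generalised, `α ≡ β` can be matched; the isomorphisms `F` and `G` may still
    -- differ, as `subset` compares nodes only.
    go : ∀ {α β} (F : s ∈ Level[ segmentΩ α ]) (G : t ∈ Level[ segmentΩ β ]) → α ≡ β →
         Injection.to (levelsCountable α) (s , F) ≡ Injection.to (levelsCountable β) (t , G) → s ≡ t
    go F G refl eq = Injection.injective (levelsCountable _) eq

  -- Countably many countable levels contain `V`, so antichains with at most one node each suffice.
  special-bounded : {V : Pred Node 0ℓ} → ∃[ γ ] (∀ {t} → t ∈ V → ¬ γ ≺ ht t) → Special V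
  special-bounded (γ , bound) = special-cover
    (λ n t → ¬ γ ≺ ht t × pair (number γ (ht t)) (levelIndex t) ≡ n)
    (λ n (p , m) (q , m′) s<t → irrefl (injective p q (trans m (sym m′))) s<t)
    (λ t∈V → _ , bound t∈V , refl)
    where
    injective : ∀ {s t} → ¬ γ ≺ ht s → ¬ γ ≺ ht t →
                pair (number γ (ht s)) (levelIndex s) ≡ pair (number γ (ht t)) (levelIndex t) → s ≡ t
    injective {s} {t} p q eq =
      let eq₁ , eq₂ = pair-injective (number γ (ht s)) (number γ (ht t)) eq
      in levelIndex-injective (number-injective p q eq₁) eq₂

  -- Regress from t to its predecessor of height β: the fibres are bounded.
  NS-bounded : {B : Pred Node 0ℓ} (R : Ord → Ord → Set) →
               (∀ β → ∃[ γ ] ∀ {α} → R β α → ¬ γ ≺ α) →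
               (∀ t → t ∈ B → t ≢ root → ∃[ β ] β ≺ ht t × R β (ht t)) → NS B
  NS-bounded {B} R bound witness =
    (λ t → g t em₀) , regressive , λ s → special-bounded (proj₁ (bound (ht s)) , fibre)
    where
    Witness : Node → Set
    Witness t = ∃[ β ] β ≺ ht t × R β (ht t)

    g : ∀ t → Dec (Witness t) → Node
    g t (yes (β , β≺ , _)) = proj₁ (restrict t β≺)
    g t (no _)             = t

    regressive : Regressive B (λ t → g t em₀)
    regressive t t∈B t≢root with em₀ {Witness t}
    ... | yes (β , β≺ , _) = proj₁ (proj₂ (restrict t β≺))
    ... | no  none         = contradiction (witness t t∈B t≢root) none

    fibre : ∀ {s t} → t ∈ B × g t em₀ ≡ s → ¬ proj₁ (bound (ht s)) ≺ ht t
    fibre {t = t} (t∈B , refl) with em₀ {Witness t}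
    ... | yes (β , β≺ , r) = proj₂ (bound _)
      (subst (λ β → R β (ht t)) (sym (proj₂ (proj₂ (restrict t β≺)))) r)
    -- A node of `B` without witness is the root, and no height lies below that of the root.
    ... | no none = λ γ≺ → none (witness t t∈B λ { refl → ≮root (proj₁ (proj₂ (restrict root γ≺))) })

  -- As `C` is closed, a height outside it has some `β` below it with no element of `C` strictly
  -- between. For fixed `β`, such heights are bounded by any element of `C` above `β`.
  NS-off-club : {C : Pred Ord 0ℓ} → Club ω₁ C → NS (λ t → ht t ∉ C)
  NS-off-club {C} (unbounded , closed) = NS-bounded
    (λ β α → ∀ γ → γ ∈ C → β ≺ γ → ¬ γ ≺ α)
    (λ β → let γ , γ∈C , β≺γ = unbounded β in γ , λ r → r γ γ∈C β≺γ)
    λ t ht∉C t≢root → dne λ none → ht∉C (closed (ht t)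
      (_ , ht-mono (root-least t t≢root))
      λ α α≺ → dne λ gap → none (α , α≺ , λ γ γ∈C α≺γ γ≺ → gap (γ , γ∈C , α≺γ , γ≺)))

  -- For fixed `β`, a strict bound of the sequence `e β` bounds the heights that some `e β n`
  -- escapes.
  NS-not-closed-under : (e : Ord → ℕ → Ord) →
                        NS (λ t → ∃[ β ] β ≺ ht t × ∃[ n ] ¬ e β n ≺ ht t)
  NS-not-closed-under e = NS-bounded (λ β α → ∃[ n ] ¬ e β n ≺ α)
    (λ β → let γ , e≺γ = bounded (e β) in γ , λ (n , e⊀α) γ≺α → e⊀α (≺-trans (e≺γ n) γ≺α))
    (λ t t∈B _ → t∈B)

  -- Going through `ht t` ensures that a height closed under `code` exceeds the codes of all nodes
  -- of smaller height.
  codeNode : Node → ℕ → Ord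
  codeNode t n = code (ht t) (pair (levelIndex t) n)

  codeNode-injective : ∀ {s t m n} → codeNode s m ≡ codeNode t n → s ≡ t × m ≡ n
  codeNode-injective {s} {t} eq =
    let ht≡ , eq′ = code-injective (ht s) (ht t) eq
        ix≡ , m≡n = pair-injective (levelIndex s) (levelIndex t) eq′
    in levelIndex-injective ht≡ ix≡ , m≡n

-- Guessing subsets of the tree

module Guessing (em : ExcludedMiddle (suc 0ℓ))
                (ω₁ : StrictPoset) (isOmega₁ : IsOmega₁ ω₁)
                (T : Tree) (isTree : IsOmega₁Tree ω₁ T)
                (nonspecial : ¬ Tree.Special T U) (diamond : ◇* ω₁) where
  open Classical em
  open Omega₁Properties em ω₁ isOmega₁ using (code)
  open StrictPoset ω₁ using () renaming (Carrier to Ord; _<_ to _≺_; _↓ to _↓Ω)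
  open Tree T
  open TreeProperties T
  open Heights em ω₁ isOmega₁ T isTree

  private
    𝒟 : Ord → Pred (Pred Ord 0ℓ) 0ℓ
    𝒟 = proj₁ diamond

    countable = proj₁ (proj₂ (proj₂ diamond))

    guesses = proj₂ (proj₂ (proj₂ diamond))

  Indexed : Ord → ℕ → Set₁
  Indexed α n = Σ[ A ∈ Pred Ord 0ℓ ] Σ[ A∈𝒟 ∈ A ∈ 𝒟 α ] Injection.to (countable α) (A , A∈𝒟) ≡ n

  -- An enumeration of `𝒟 α`, up to `≐`, with `∅` at numbers that index no member.
  nth : Ord → ℕ → Pred Ord 0ℓ
  nth α n with em {Indexed α n}
  ... | yes (A , _) = A
  ... | no  _       = ∅

  -- The set found need not be `A`, but it has the same index.
  nth-≐ : ∀ {α A} (A∈𝒟 : A ∈ 𝒟 α) → nth α (Injection.to (countable α) (A , A∈𝒟)) ≐ A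
  nth-≐ {α} {A} A∈𝒟 with em {Indexed α (Injection.to (countable α) (A , A∈𝒟))}
  ... | yes (A′ , A′∈𝒟 , eq) = Injection.injective (countable α) eq
  ... | no  none             = contradiction (A , A∈𝒟 , refl) none

  -- The diagonal trick: `n` selects both the set at height `ht t` and the slice of nodes decoded
  -- from it.
  guess : ℕ → Node → Pred Node 0ℓ
  guess n t s = s < t × codeNode s n ∈ nth (ht t) n

  Guesses : (Node → Pred Node 0ℓ) → Pred Node 0ℓ → Pred Node 0ℓ
  Guesses D X t = (X ∩ t ↓) ≐ D t

  not-all-defeated : ¬ (∀ n → Σ[ X ∈ Pred Node 0ℓ ] NS (Guesses (guess n) X))
  not-all-defeated defeated = nonspecial (special-if-NS em₀ (NS-⋃ em₀ B B-NS λ {t} _ → cover t))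
    where
    X : ℕ → Pred Node 0ℓ
    X n = proj₁ (defeated n)

    -- One subset of ω₁ codes all the sets `X n` at once.
    X̂ : Pred Ord 0ℓ
    X̂ γ = ∃[ n ] ∃[ s ] s ∈ X n × codeNode s n ≡ γ

    C : Pred Ord 0ℓ
    C = proj₁ (guesses X̂)

    -- The first two sets hold the nodes where capturing may fail; the others hold the correct
    -- guesses.
    B : ℕ → Pred Node 0ℓ
    B 0                 t = ht t ∉ C
    B 1                 t = ∃[ β ] β ≺ ht t × ∃[ n ] ¬ code β n ≺ ht t
    B (ℕ.suc (ℕ.suc n)) = Guesses (guess n) (X n)

    B-NS : ∀ n → NS (B n)
    B-NS 0                 = NS-off-club (proj₁ (proj₂ (guesses X̂)))
    B-NS 1                 = NS-not-closed-under code
    B-NS (ℕ.suc (ℕ.suc n)) = proj₂ (defeated n)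

    -- If `A` has index `n`, the `n`-th guess decodes slice `n` of `X̂`, which is `X n` by
    -- injectivity of the coding. Closure places the codes of predecessors of `t` below `ht t`,
    -- where `A` agrees with `X̂`.
    captured : ∀ t {A} (A∈𝒟 : A ∈ 𝒟 (ht t)) → A ≐ (X̂ ∩ ht t ↓Ω) →
               (∀ {β} → β ≺ ht t → ∀ n → code β n ≺ ht t) →
               let n = Injection.to (countable (ht t)) (_ , A∈𝒟) in t ∈ Guesses (guess n) (X n)
    captured t A∈𝒟 (A⊆X̂ , X̂⊆A) closed =
      (λ (s∈X , s<t) → s<t ,
        proj₂ (nth-≐ A∈𝒟) (X̂⊆A ((_ , _ , s∈X , refl) , closed (ht-mono s<t) _))) ,
      (λ (s<t , s∈) → decode (proj₁ (A⊆X̂ (proj₁ (nth-≐ A∈𝒟) s∈))) , s<t)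
      where
      decode : ∀ {s n} → codeNode s n ∈ X̂ → s ∈ X n
      decode (n , s , s∈X , eq) with refl , refl ← codeNode-injective eq = s∈X

    cover : ∀ t → t ∈ ⋃ ℕ B
    cover t with em₀ {t ∈ B 0} | em₀ {t ∈ B 1}
    ... | yes t∈B | _       = 0 , t∈B
    ... | no _    | yes t∈B = 1 , t∈B
    ... | no ht∈C | no closed =
      let A , A∈𝒟 , A≐X̂ = proj₂ (proj₂ (guesses X̂)) (dne ht∈C)
      in ℕ.suc (ℕ.suc (Injection.to (countable (ht t)) (A , A∈𝒟))) ,
         captured t A∈𝒟 A≐X̂ λ β≺ n → dne λ c⊀ → closed (_ , β≺ , n , c⊀)

  diamondTree : ◇
  diamondTree with em {Σ[ n ∈ ℕ ] ∀ X → ¬ NS (Guesses (guess n) X)}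
  ... | yes (n , never) = guess n , (λ t → proj₁) , never
  ... | no  none        = contradiction defeated not-all-defeated
    where
    defeated : ∀ n → Σ[ X ∈ Pred Node 0ℓ ] NS (Guesses (guess n) X)
    -- Double negation elimination in `Set₁` produces an actual `X` for each `n`, in place of
    -- countable choice.
    defeated n = em⇒dne em λ undefeated → none (n , λ X ns → undefeated (X , ns))

corollary4p3 : ExcludedMiddle (suc 0ℓ) →
    (ω₁ : StrictPoset) → IsOmega₁ ω₁ →
    (T : Tree) → IsOmega₁Tree ω₁ T → WellPruned ω₁ T → ¬ (Tree.Special T U) →
    ◇* ω₁ → Tree.◇ T
corollary4p3 em ω₁ isOmega₁ T isTree _ nonspecial diamond =
  Guessing.diamondTree em ω₁ isOmega₁ T isTree nonspecial diamond
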